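{- Let $n \ge 5$, let $T$ be the star $K_{1,n-1}$ on vertex set $\{1,2,\ldots,n\}$ whose center vertex has label $1$, and let $\Gamma$ be the Cayley graph of $S_n$ generated by the transpositions $(i,j)$ such that $ij$ is an edge of $T$. Then for every $\pi \in S_n$, $$\mathrm{dist}_{\Gamma}(I,\pi) = n+c(\pi)-2|\mathrm{Fix}(\pi)| - r(\pi),$$ where $r(\pi)=0$ if $\pi(1)=1$ and $r(\pi)=2$ otherwise; and $$\mathrm{diam}(\Gamma) = \max_{\pi \in S_n} \left\{ c(\pi)-n+\sum_{i=1}^n \mathrm{dist}_T(i,\pi(i)) \right\}.$$
   Context: $S_n$ is the symmetric group on $\{1,\ldots,n\}$ and $I$ is its identity; the product $\pi\tau$ means apply $\tau$ first, then $\pi$. For a tree $T$ on vertex set $\{1,\ldots,n\}$ (a transposition tree), each edge $ij$ is identified with the transposition $(i,j)$, and the Cayley graph $\Gamma$ generated by $T$ is the simple undirected graph with vertex set $S_n$ in which $g$ and $h$ are adjacent iff $h = gs$ for some transposition $s$ that is an edge of $T$. $\mathrm{dist}_G(u,v)$ denotes the distance between vertices $u,v$ in a graph $G$, and $\mathrm{diam}(G)$ its diameter. $c(\pi)$ is the number of cycles of $\pi$, including cycles of length 1, and $\mathrm{Fix}(\pi)$ is the set of fixed points of $\pi$. -}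

module Defs where

open import Data.Bool.Base using (if_then_else_)
open import Data.Bool.Properties using () renaming (_≟_ to _≟ᵇ_)
open import Data.Fin.Base using (Fin; zero; suc; toℕ; fromℕ<)
open import Data.Fin.Permutation using (Permutation′; _⟨$⟩ʳ_; _⟨$⟩ˡ_; _∘ₚ_; transpose; inverseˡ) renaming (_≈_ to _≈ₚ_)
open import Data.Fin.Permutation.Components using (transpose-inverse)
open import Data.Fin.Properties using (_≟_; any?; pigeonhole; toℕ<n; toℕ-fromℕ<)
open import Data.Fin.Subset using (Subset)
open import Data.Integer.Base using (ℤ) renaming (_≤_ to _≤ℤ_)
open import Data.List.Base using (List; allFin; deduplicate; length; map)
open import Data.Nat.Base using (ℕ; zero; suc; _+_; _*_; _∸_; _≤_; _<_; z≤n; s≤s; NonZero; >-nonZero)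
open import Data.Nat.DivMod using (_/_; _%_; m≡m%n+[m/n]*n; m%n<n)
open import Data.Nat.GeneralisedArithmetic using (iterate)
open import Data.Nat.Properties using (+-comm; <-≤-trans; ≤-trans; m∸n≤m; m∸n+n≡m; <⇒≤; m<n⇒0<n∸m; n<1+n; ≤-pred)
open import Data.Product.Base using (∃-syntax; ∃₂; _×_; _,_; proj₁)
open import Data.Sum.Base using (_⊎_; inj₁; inj₂)
open import Data.Vec.Base using (tabulate)
open import Data.Vec.Properties using (≡-dec)
open import Level using (0ℓ)
open import Relation.Binary.Bundles using (Setoid)
open import Relation.Binary.Core using (Rel)
open import Relation.Binary.Definitions using (Symmetric; _Respects₂_) renaming (Decidable to Decidable₂)
open import Relation.Binary.PropositionalEquality using (_≡_; _≢_; refl; sym; trans; cong; setoid)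
open import Relation.Nullary.Decidable using (Dec; yes; no; does; map′; ¬?; _×-dec_; _⊎-dec_)
open import Relation.Nullary.Negation using (¬_; contradiction)
open import Relation.Unary using (Decidable)

------------------------------------------------------------------------
-- Graphs, distance and diameter

record SimpleGraph (V : Setoid 0ℓ 0ℓ) : Set₁ where
  open Setoid V using (Carrier; _≈_)
  infix 4 _~_
  field
    _~_      : Rel Carrier 0ℓ
    ~-resp   : _~_ Respects₂ _≈_
    ~-sym    : Symmetric _~_
    ~-irrefl : ∀ {u v} → u ≈ v → ¬ (u ~ v)

module _ {V : Setoid 0ℓ 0ℓ} (G : SimpleGraph V) where
  open Setoid V using (Carrier; _≈_)
  open SimpleGraph G

  data Walk : ℕ → Carrier → Carrier → Set where
    []  : ∀ {u v} → u ≈ v → Walk 0 u v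
    _∷_ : ∀ {k u v w} → u ~ v → Walk k v w → Walk (suc k) u w

  Connected : Set
  Connected = ∀ u v → ∃[ k ] Walk k u v

  -- dist u v = d.  It never holds when u and v lie in different components.
  IsDistance : Carrier → Carrier → ℕ → Set
  IsDistance u v d = Walk d u v × (∀ k → Walk k u v → d ≤ k)

  -- diam G = D.  It never holds when G is disconnected.
  IsDiameter : ℕ → Set
  IsDiameter D = (∀ u v → ∃[ d ] IsDistance u v d × d ≤ D)
               × (∃₂ λ u v → IsDistance u v D)

IsMaximum : {A : Set} → (A → ℤ) → ℤ → Set
IsMaximum f M = (∀ a → f a ≤ℤ M) × ∃[ a ] f a ≡ M

-- On a finite connected graph with decidable adjacency the distance is a
-- computable function.

least : {P : ℕ → Set} → Decidable P → ∀ k → P k →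
        ∃[ d ] P d × (∀ l → P l → d ≤ l)
least P? k pk with P? 0
least P? k       pk | yes p0 = 0 , p0 , λ _ _ → z≤n
least P? zero    pk | no ¬p0 = contradiction pk ¬p0
least P? (suc k) pk | no ¬p0 with least (λ l → P? (suc l)) k pk
... | d , pd , min = suc d , pd , λ where
  zero    p0 → contradiction p0 ¬p0
  (suc l) pl → s≤s (min l pl)

module _ {n : ℕ} (G : SimpleGraph (setoid (Fin n))) where
  open SimpleGraph G

  walk? : Decidable₂ _~_ → ∀ k u v → Dec (Walk G k u v)
  walk? _~?_ zero    u w = map′ [] (λ { ([] u≡w) → u≡w }) (u ≟ w)
  walk? _~?_ (suc k) u w =
    map′ (λ (_ , e , p) → e ∷ p) (λ { (e ∷ p) → _ , e , p })
         (any? λ v → (u ~? v) ×-dec walk? _~?_ k v w)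

  distance : Decidable₂ _~_ → Connected G → ∀ u v → ∃[ d ] IsDistance G u v d
  distance _~?_ connected u v =
    let k , p = connected u v in least (λ l → walk? _~?_ l u v) k p

------------------------------------------------------------------------
-- The star K_{1,m} on Fin (suc m): the vertex labelled k ∈ {1, …, n} is
-- the element with toℕ equal to k - 1, so the centre, labelled 1, is zero.

star : ∀ m → SimpleGraph (setoid (Fin (suc m)))
star m = record
  { _~_      = λ i j → (i ≡ zero × j ≢ zero) ⊎ (i ≢ zero × j ≡ zero)
  ; ~-resp   = (λ { refl e → e }) , (λ { refl e → e })
  ; ~-sym    = λ { (inj₁ (p , q)) → inj₂ (q , p) ; (inj₂ (p , q)) → inj₁ (q , p) }
  ; ~-irrefl = λ { refl (inj₁ (p , q)) → q p ; refl (inj₂ (p , q)) → p q }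
  }

star-~? : ∀ m → Decidable₂ (SimpleGraph._~_ (star m))
star-~? m i j = ((i ≟ zero) ×-dec ¬? (j ≟ zero)) ⊎-dec (¬? (i ≟ zero) ×-dec (j ≟ zero))

star-connected : ∀ m → Connected (star m)
star-connected m zero    zero    = 0 , [] refl
star-connected m zero    (suc j) = 1 , inj₁ (refl , λ ()) ∷ [] refl
star-connected m (suc i) zero    = 1 , inj₂ ((λ ()) , refl) ∷ [] refl
star-connected m (suc i) (suc j) = 2 , inj₂ ((λ ()) , refl) ∷ (inj₁ (refl , λ ()) ∷ [] refl)

distStar : ∀ m → Fin (suc m) → Fin (suc m) → ℕ
distStar m i j = proj₁ (distance (star m) (star-~? m) (star-connected m) i j)

------------------------------------------------------------------------
-- Cayley graphs of the symmetric group

-- Permutations are compared pointwise.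
Sym : ℕ → Setoid 0ℓ 0ℓ
Sym n = record
  { Carrier       = Permutation′ n
  ; _≈_           = _≈ₚ_
  ; isEquivalence = record
    { refl  = λ _ → refl
    ; sym   = λ p i → sym (p i)
    ; trans = λ p q i → trans (p i) (q i)
    }
  }

-- The product that applies τ first; _∘ₚ_ is in diagrammatic order.
infixl 7 _·_
_·_ : ∀ {n} → Permutation′ n → Permutation′ n → Permutation′ n
π · τ = τ ∘ₚ π

transpose-i : ∀ {n} (i j : Fin n) → transpose i j ⟨$⟩ʳ i ≡ j
transpose-i i j with i ≟ i
... | yes _  = refl
... | no i≢i = contradiction refl i≢i

⟨$⟩ʳ-injective : ∀ {n} (π : Permutation′ n) {i j} → π ⟨$⟩ʳ i ≡ π ⟨$⟩ʳ j → i ≡ j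
⟨$⟩ʳ-injective π eq = trans (sym (inverseˡ π)) (trans (cong (π ⟨$⟩ˡ_) eq) (inverseˡ π))

Cayley : ∀ {n} → SimpleGraph (setoid (Fin n)) → SimpleGraph (Sym n)
Cayley {n} T = record
  { _~_      = λ g h → ∃₂ λ i j → i ~ j × h ≈ₚ g · transpose i j
  ; ~-resp   = (λ h≈h′ (i , j , e , p) → i , j , e , λ x → trans (sym (h≈h′ x)) (p x))
             , (λ g≈g′ (i , j , e , p) → i , j , e , λ x → trans (p x) (g≈g′ _))
  ; ~-sym    = λ {g} (i , j , e , p) → j , i , ~-sym e , λ x →
                 sym (trans (p _) (cong (g ⟨$⟩ʳ_) (transpose-inverse i j)))
  ; ~-irrefl = λ {g} g≈h (i , j , e , p) → ~-irrefl
                 (trans (⟨$⟩ʳ-injective g (trans (g≈h i) (p i))) (transpose-i i j)) e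
  }
  where open SimpleGraph T

------------------------------------------------------------------------
-- Cycles and fixed points

module _ {n : ℕ} (π : Permutation′ n) where

  SameCycle : Rel (Fin n) 0ℓ
  SameCycle i j = ∃[ k ] iterate (π ⟨$⟩ʳ_) i k ≡ j

  private
    f : Fin n → Fin n
    f = π ⟨$⟩ʳ_

  iterate-+ : ∀ x a b → iterate f x (a + b) ≡ iterate f (iterate f x a) b
  iterate-+ x zero    b = refl
  iterate-+ x (suc a) b = iterate-+ (f x) a b

  iterate-injective : ∀ a {x y} → iterate f x a ≡ iterate f y a → x ≡ y
  iterate-injective zero    eq = eq
  iterate-injective (suc a) eq = ⟨$⟩ʳ-injective π (iterate-injective a eq)

  iterate-period : ∀ x p q → iterate f x p ≡ x → iterate f x (q * p) ≡ x
  iterate-period x p zero    eq = refl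
  iterate-period x p (suc q) eq = trans (iterate-+ x p (q * p))
    (trans (cong (λ y → iterate f y (q * p)) eq) (iterate-period x p q eq))

  period : ∀ x → ∃[ p ] 0 < p × p ≤ n × iterate f x p ≡ x
  period x with pigeonhole (n<1+n n) (λ (k : Fin (suc n)) → iterate f x (toℕ k))
  ... | a , b , a<b , eq =
    toℕ b ∸ toℕ a , m<n⇒0<n∸m a<b ,
    ≤-trans (m∸n≤m (toℕ b) (toℕ a)) (≤-pred (toℕ<n b)) ,
    iterate-injective (toℕ a)
      (trans (sym (iterate-+ x (toℕ b ∸ toℕ a) (toℕ a)))
        (trans (cong (iterate f x) (m∸n+n≡m (<⇒≤ a<b))) (sym eq)))

  sameCycle-bounded : ∀ {i j} → SameCycle i j → ∃[ k ] iterate f i (toℕ {n} k) ≡ j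
  sameCycle-bounded {i} (k , eq) with period i
  ... | p , 0<p , p≤n , per = fromℕ< r<n ,
    trans (cong (iterate f i) (toℕ-fromℕ< r<n)) (trans (sym reduce) eq)
    where
    instance
      p≢0 : NonZero p
      p≢0 = >-nonZero 0<p

    r<n : k % p < n
    r<n = <-≤-trans (m%n<n k p) p≤n

    reduce : iterate f i k ≡ iterate f i (k % p)
    reduce = trans
      (cong (iterate f i) (trans (m≡m%n+[m/n]*n k p) (+-comm (k % p) _)))
      (trans (iterate-+ i (k / p * p) (k % p))
        (cong (λ y → iterate f y (k % p)) (iterate-period i p (k / p) per)))

  sameCycle? : Decidable₂ SameCycle
  sameCycle? i j = map′ (λ (k , eq) → toℕ k , eq) sameCycle-bounded
    (any? λ k → iterate f i (toℕ k) ≟ j)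

  cycleOf : Fin n → Subset n
  cycleOf i = tabulate λ j → does (sameCycle? i j)

  -- The distinct sets cycleOf i; a fixed point contributes a singleton.
  cycles : List (Subset n)
  cycles = deduplicate (≡-dec _≟ᵇ_) (map cycleOf (allFin n))

  c : ℕ
  c = length cycles

  Fix : Subset n
  Fix = tabulate λ i → does (π ⟨$⟩ʳ i ≟ i)

r : ∀ {m} → Permutation′ (suc m) → ℕ
r π = if does (π ⟨$⟩ʳ zero ≟ zero) then 0 else 2

{-# OPTIONS --safe #-}
module Submission where

-- Write n = m + 1 and let L π be the number of fixed points of π other than the
-- centre.  Since 2 |Fix π| + r π = 2 + 2 L π, the claimed distance is
-- φ π = m + c π - 1 - 2 L π.  Multiplying π by a transposition (a b) splits the
-- cycle through a and b or merges their two cycles, and if a is the centre it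
-- changes L only through the status of b.  Hence φ changes by exactly one along
-- every edge of Γ, which bounds distances from below.  Unless π = I some edge
-- decreases φ: take b = π a if this is not a, and any non-fixed b otherwise.
--
-- Left multiplication is an automorphism of Γ, so the diameter is the maximum
-- of φ.  The tree distances between i and π i sum to 2n - 2 |Fix π| - r π, as
-- only the steps to and from a moved centre are shorter than 2; so the
-- expression maximised over π is φ π too.

open import Defs
open import Data.Bool.Base using (Bool; true; false; if_then_else_)
open import Data.Bool.Properties using () renaming (_≟_ to _≟ᵇ_)
open import Data.Fin.Base using (Fin; zero; suc; punchIn)
open import Data.Fin.Permutation using (Permutation′; id; _⟨$⟩ʳ_; flip; transpose; inverseˡ; inverseʳ)
open import Data.Fin.Properties using (_≟_; all?; punchInᵢ≢i; suc-injective; ¬∀⟶∃¬)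
open import Data.Fin.Subset using (∣_∣)
open import Data.List.Base as List using (List; []; _∷_; [_]; _++_; allFin; concatMap; deduplicate; filter; length; map; upTo)
open import Data.List.Membership.Propositional using (_∈_; lose; find)
open import Data.List.Membership.Propositional.Properties using (∈-map⁺; ∈-map⁻; ∈-allFin; ∈-upTo⁺; ∈-deduplicate⁺; ∈-deduplicate⁻; ∈-filter⁺; ∈-filter⁻)
open import Data.List.Membership.Propositional.Properties.WithK using (unique∧set⇒bag)
open import Data.List.Properties using (length-++; length-map; length-filter; length-tabulate; length-deduplicate)
open import Data.List.Relation.Binary.BagAndSetEquality using (∼bag⇒↭)
open import Data.List.Relation.Binary.Permutation.Propositional.Properties using (↭-length)
open import Data.List.Relation.Unary.All as All using (All; []; _∷_)
import Data.List.Relation.Unary.All.Properties as All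
open import Data.List.Relation.Unary.AllPairs as AllPairs using (AllPairs; []; _∷_)
import Data.List.Relation.Unary.AllPairs.Properties as AllPairs
open import Data.List.Relation.Unary.Any as Any using (Any; here; there)
import Data.List.Relation.Unary.Any.Properties as Any
import Data.List.Relation.Unary.Unique.DecPropositional.Properties as UniqueDecPropositional
import Data.List.Relation.Unary.Unique.DecSetoid.Properties as UniqueDecSetoid
open import Data.Nat.Base as ℕ using (ℕ; zero; suc; _∸_; _≤_; z≤n; s≤s; >-nonZero)
open import Data.Nat.GeneralisedArithmetic using (iterate)
open import Data.Nat.Properties using (+-0-commutativeMonoid; +-cancelʳ-≡; +-cancelʳ-≤; +-comm; +-identityʳ; +-mono-≤; +-monoʳ-≤; +-monoˡ-≤; *-identityʳ; *-monoʳ-≤; *-zeroʳ; 1+n≰n; m+[n∸m]≡n; m∸n+n≡m; m∸n≤m; m≤m*n; m≤m+n; n≤0⇒n≡0; ≤-antisym; ≤-refl; ≤-reflexive; ≤-totalOrder; ≤-trans; module ≤-Reasoning) renaming (suc-injective to ℕ-suc-injective)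
open import Algebra.Properties.CommutativeMonoid.Sum +-0-commutativeMonoid using (sum; sum-syntax; sum-cong-≗; sum-remove; sum-permute; ∑-distrib-+)
open import Data.List.Extrema ≤-totalOrder using (argmax; v≤f[argmax]⁺)
open import Data.Nat.Tactic.RingSolver using (solve-∀)
open import Data.Product.Base using (∃-syntax; _×_; _,_; proj₁; proj₂)
open import Data.Sum.Base using (_⊎_; inj₁; inj₂)
open import Data.Vec.Base as Vec using (lookup)
open import Data.Vec.Properties using (≡-dec; lookup∘tabulate; tabulate-cong)
open import Function.Base using (_∘_)
open import Function.Bundles using (mk⇔)
open import Level using (0ℓ)
open import Relation.Binary.Bundles using (DecSetoid)
open import Relation.Binary.PropositionalEquality using (_≡_; _≢_; refl; sym; trans; cong; cong₂; subst; subst₂; module ≡-Reasoning)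
open import Relation.Nullary.Decidable using (Dec; yes; no; does; ¬?; does-⇔; dec-true; dec-false)
open import Relation.Nullary.Negation using (¬_; contradiction)
open import Relation.Unary using (Decidable)

-- Cycles as equivalence classes, and counting them by representatives.

module _ {n} (π : Permutation′ n) where
  open import Data.Nat.Base using (_+_; _*_)

  sameCycle-refl : ∀ {x} → SameCycle π x x
  sameCycle-refl = 0 , refl

  sameCycle-trans : ∀ {x y z} → SameCycle π x y → SameCycle π y z → SameCycle π x z
  sameCycle-trans {x} (k , p) (l , q) =
    k + l , trans (iterate-+ π x k l) (trans (cong (λ y → iterate (π ⟨$⟩ʳ_) y l) p) q)

  -- With a positive period `q` of `x`, the first `k * q` steps from `x` end at `x` and pass through
  -- `y` after `k` of them; the remaining `k * q ∸ k` lead from `y` to `x`.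
  sameCycle-sym : ∀ {x y} → SameCycle π x y → SameCycle π y x
  sameCycle-sym {x} {y} (k , p) with period π x
  ... | q , 0<q , _ , per = k * q ∸ k , trans (cong (λ z → iterate (π ⟨$⟩ʳ_) z (k * q ∸ k)) (sym p))
    (trans (sym (iterate-+ π x k (k * q ∸ k)))
      (trans (cong (iterate (π ⟨$⟩ʳ_) x) (m+[n∸m]≡n (m≤m*n k q {{>-nonZero 0<q}})))
        (iterate-period π x q k per)))

  sameCycle-step : ∀ {x} → SameCycle π x (π ⟨$⟩ʳ x)
  sameCycle-step = 1 , refl

  -- Since `SameCycle π` is the reflexive transitive closure of single steps of `π`, its inclusion
  -- in a preorder can be checked on those steps. Comparisons between the cycles of different
  -- permutations go through this.
  sameCycle-least : {E : Fin n → Fin n → Set} → (∀ {x} → E x x) →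
                    (∀ {x y z} → E x y → E y z → E x z) → (∀ x → E x (π ⟨$⟩ʳ x)) →
                    ∀ {x y} → SameCycle π x y → E x y
  sameCycle-least {E} E-refl E-trans step (k , p) = subst (E _) p (go k)
    where
    go : ∀ k {x} → E x (iterate (π ⟨$⟩ʳ_) x k)
    go zero    = E-refl
    go (suc k) = E-trans (step _) (go k)

  sameCycle-fixed : ∀ {x y} → π ⟨$⟩ʳ x ≡ x → SameCycle π x y → x ≡ y
  sameCycle-fixed {x} fix (k , p) = trans (sym (go k)) p
    where
    go : ∀ k → iterate (π ⟨$⟩ʳ_) x k ≡ x
    go zero    = refl
    go (suc k) = trans (cong (λ z → iterate (π ⟨$⟩ʳ_) z k) fix) (go k)

  sameCycle-moved : ∀ {x y} → x ≢ y → SameCycle π x y → π ⟨$⟩ʳ y ≢ y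
  sameCycle-moved x≢y x~y fix = x≢y (sym (sameCycle-fixed fix (sameCycle-sym x~y)))

  sameCycle-decSetoid : DecSetoid 0ℓ 0ℓ
  sameCycle-decSetoid = record
    { Carrier = Fin n
    ; _≈_ = SameCycle π
    ; isDecEquivalence = record
      { isEquivalence = record
        { refl = sameCycle-refl ; sym = sameCycle-sym ; trans = sameCycle-trans }
      ; _≟_ = sameCycle? π
      }
    }

  cycleOf-cong : ∀ {x y} → SameCycle π x y → cycleOf π x ≡ cycleOf π y
  cycleOf-cong x~y = tabulate-cong λ z →
    does-⇔ (mk⇔ (sameCycle-trans (sameCycle-sym x~y)) (sameCycle-trans x~y))
      (sameCycle? π _ z) (sameCycle? π _ z)

  cycleOf-injective : ∀ {x y} → cycleOf π x ≡ cycleOf π y → SameCycle π x y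
  cycleOf-injective {x} {y} eq with sameCycle? π x y in dec
  ... | yes x~y = x~y
  ... | no _ = contradiction (trans (sym (cong does dec)) does≡true) λ ()
    where
    does≡true : does (sameCycle? π x y) ≡ _
    does≡true = trans (sym (lookup∘tabulate _ y))
      (trans (cong (λ p → lookup p y) eq)
        (trans (lookup∘tabulate _ y) (dec-true (sameCycle? π y y) sameCycle-refl)))

  Independent : List (Fin n) → Set
  Independent = AllPairs (λ x y → ¬ SameCycle π x y)

  -- One representative per cycle. Lists of points can be shared or edited between two permutations,
  -- unlike the lists of subsets that define `c`.
  Transversal : List (Fin n) → Set
  Transversal xs = Independent xs × (∀ i → Any (SameCycle π i) xs)

  -- `map (cycleOf π) xs` and `cycles π` are duplicate-free with the same members, hence
  -- rearrangements of each other.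
  length-transversal : ∀ {xs} → Transversal xs → length xs ≡ c π
  length-transversal {xs} (independent , covers) =
    trans (sym (length-map (cycleOf π) xs)) (↭-length (∼bag⇒↭
      (unique∧set⇒bag
        (AllPairs.map⁺ (AllPairs.map (_∘ cycleOf-injective) independent))
        (UniqueDecPropositional.deduplicate-! (≡-dec _≟ᵇ_) _)
        (mk⇔ to from))))
    where
    to : ∀ {p} → p ∈ map (cycleOf π) xs → p ∈ cycles π
    to p∈ with ∈-map⁻ (cycleOf π) p∈
    ... | i , _ , refl = ∈-deduplicate⁺ (≡-dec _≟ᵇ_) (∈-map⁺ (cycleOf π) (∈-allFin i))

    from : ∀ {p} → p ∈ cycles π → p ∈ map (cycleOf π) xs
    from p∈ with ∈-map⁻ (cycleOf π) (∈-deduplicate⁻ (≡-dec _≟ᵇ_) _ p∈)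
    ... | i , _ , refl with find (covers i)
    ... | x , x∈xs , i~x rewrite cycleOf-cong i~x = ∈-map⁺ (cycleOf π) x∈xs

  -- `ys` keeps one point from each cycle that misses `xs`. This allows a transversal to start with
  -- prescribed points.
  extend : ∀ {xs} → Independent xs → ∃[ ys ] Transversal (xs ++ ys)
  extend {xs} independent = ys , AllPairs.++⁺ independent
      (UniqueDecSetoid.deduplicate-! sameCycle-decSetoid _)
      (All.tabulate λ x∈xs → All.tabulate λ y∈ys x~y →
        proj₂ (∈-filter⁻ new? {xs = allFin n} (∈-deduplicate⁻ (sameCycle? π) _ y∈ys))
          (lose x∈xs (sameCycle-sym x~y)))
    , covers
    where
    new? = λ i → ¬? (Any.any? (sameCycle? π i) xs)
    ys = deduplicate (sameCycle? π) (filter new? (allFin n))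

    covers : ∀ i → Any (SameCycle π i) (xs ++ ys)
    covers i with Any.any? (sameCycle? π i) xs
    ... | yes old = Any.++⁺ˡ old
    ... | no  new = Any.++⁺ʳ xs (Any.deduplicate⁺ (sameCycle? π)
      (λ y~x i~x → sameCycle-trans i~x (sameCycle-sym y~x))
      (lose (∈-filter⁺ new? (∈-allFin i) new) sameCycle-refl))

  length≤c : ∀ {xs} → Independent xs → length xs ≤ c π
  length≤c {xs} independent with extend independent
  ... | ys , transversal = subst (length xs ≤_)
    (trans (sym (length-++ xs)) (length-transversal transversal)) (m≤m+n _ _)

c-cong : ∀ {n} {π σ : Permutation′ n} → (∀ x → π ⟨$⟩ʳ x ≡ σ ⟨$⟩ʳ x) → c π ≡ c σ
c-cong {π = π} {σ} π≈σ with extend π []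
... | xs , independent , covers = trans (sym (length-transversal π (independent , covers)))
  (length-transversal σ (AllPairs.map (_∘ from) independent , λ i → Any.map to (covers i)))
  where
  to : ∀ {x y} → SameCycle π x y → SameCycle σ x y
  to = sameCycle-least π (sameCycle-refl σ) (sameCycle-trans σ) (λ x → 1 , sym (π≈σ x))
  from : ∀ {x y} → SameCycle σ x y → SameCycle π x y
  from = sameCycle-least σ (sameCycle-refl π) (sameCycle-trans π) (λ x → 1 , π≈σ x)

-- A transposition merges two cycles or splits one.

-- σ = π · (a b)
record Swapped {n} (π σ : Permutation′ n) (a b : Fin n) : Set where
  constructor swapped
  field
    at-a      : σ ⟨$⟩ʳ a ≡ π ⟨$⟩ʳ b
    at-b      : σ ⟨$⟩ʳ b ≡ π ⟨$⟩ʳ a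
    elsewhere : ∀ {x} → x ≢ a → x ≢ b → σ ⟨$⟩ʳ x ≡ π ⟨$⟩ʳ x

swapped-sym : ∀ {n} {π σ : Permutation′ n} {a b} → Swapped π σ a b → Swapped σ π a b
swapped-sym (swapped p q e) = swapped (sym q) (sym p) λ x≢a x≢b → sym (e x≢a x≢b)

module _ {n} {π σ : Permutation′ n} {a b : Fin n} (sw : Swapped π σ a b) where
  open Swapped sw

  module _ (a≁b : ¬ SameCycle π a b) where

    private
      J : Fin n → Set
      J x = SameCycle π a x ⊎ SameCycle π b x

      -- The cycle relation of π with the cycles of a and b merged.
      E : Fin n → Fin n → Set
      E x y = SameCycle π x y ⊎ (J x × J y)

      J-resp : ∀ {x y} → SameCycle π x y → J x → J y
      J-resp x~y (inj₁ a~x) = inj₁ (sameCycle-trans π a~x x~y)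
      J-resp x~y (inj₂ b~x) = inj₂ (sameCycle-trans π b~x x~y)

      E-trans : ∀ {x y z} → E x y → E y z → E x z
      E-trans (inj₁ p)        (inj₁ q)        = inj₁ (sameCycle-trans π p q)
      E-trans (inj₁ p)        (inj₂ (jy , jz)) = inj₂ (J-resp (sameCycle-sym π p) jy , jz)
      E-trans (inj₂ (jx , jy)) (inj₁ q)        = inj₂ (jx , J-resp q jy)
      E-trans (inj₂ (jx , _)) (inj₂ (_ , jz)) = inj₂ (jx , jz)

      E-step : ∀ x → E x (σ ⟨$⟩ʳ x)
      E-step x with x ≟ a | x ≟ b
      ... | yes refl | _        = inj₂ (inj₁ (sameCycle-refl π) , inj₂ (1 , sym at-a))
      ... | no _     | yes refl = inj₂ (inj₂ (sameCycle-refl π) , inj₁ (1 , sym at-b))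
      ... | no x≢a   | no x≢b   = inj₁ (1 , sym (elsewhere x≢a x≢b))

      σ⇒E : ∀ {x y} → SameCycle σ x y → E x y
      σ⇒E = sameCycle-least σ (inj₁ (sameCycle-refl π)) E-trans E-step

      -- σ follows π from π a until it returns to a.
      return : ∀ k y → iterate (π ⟨$⟩ʳ_) y k ≡ a → ¬ SameCycle π y b → SameCycle σ y a
      return zero    y p y≁b = 0 , p
      return (suc k) y p y≁b with y ≟ a
      ... | yes y≡a = 0 , y≡a
      ... | no y≢a = sameCycle-trans σ (1 , elsewhere y≢a (λ y≡b → y≁b (0 , y≡b)))
        (return k (π ⟨$⟩ʳ y) p (y≁b ∘ sameCycle-trans π (sameCycle-step π)))

      -- `σ` sends `b` to `π a`. The path of `π` from there back to `a` avoids `b`, which lies in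
      -- another cycle, so `σ` follows it.
      b~a : SameCycle σ b a
      b~a with sameCycle-sym π (sameCycle-step π {a})
      ... | k , p = sameCycle-trans σ (1 , at-b)
        (return k _ p (a≁b ∘ sameCycle-trans π (sameCycle-step π)))

      π⇒σ : ∀ {x y} → SameCycle π x y → SameCycle σ x y
      π⇒σ = sameCycle-least π (sameCycle-refl σ) (sameCycle-trans σ) step
        where
        step : ∀ x → SameCycle σ x (π ⟨$⟩ʳ x)
        step x with x ≟ a | x ≟ b
        -- The steps of `π` out of `a` and `b` end at `σ b` and `σ a`, which share a cycle of `σ` by
        -- `b~a`.
        ... | yes refl | _        = sameCycle-trans σ (sameCycle-sym σ b~a) (1 , at-b)
        ... | no _     | yes refl = sameCycle-trans σ b~a (1 , at-a)
        ... | no x≢a   | no x≢b   = 1 , elsewhere x≢a x≢b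

    -- A transversal of `π` beginning with `a` and `b` becomes one of `σ` once `b` is dropped: the
    -- other representatives lie outside `J`, where `E` reduces to `SameCycle π`.
    c-merge : suc (c σ) ≡ c π
    c-merge with extend π ((a≁b ∷ []) ∷ [] ∷ [])
    ... | ys , (((_ ∷ a≁ys) ∷ b≁ys ∷ independent) , covers) =
      trans (cong suc (sym (length-transversal σ {a ∷ ys} (independent′ , covers′))))
        (length-transversal π (((a≁b ∷ a≁ys) ∷ b≁ys ∷ independent) , covers))
      where
      ¬J : All (λ y → ¬ J y) ys
      ¬J = All.zipWith (λ { (p , q) (inj₁ a~y) → p a~y ; (p , q) (inj₂ b~y) → q b~y }) (a≁ys , b≁ys)

      independent′ : Independent σ (a ∷ ys)
      independent′ = All.map (λ ¬Jy a~y → ¬Jy (case-J (σ⇒E a~y))) ¬J ∷ rest ys ¬J independent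
        where
        case-J : ∀ {y} → E a y → J y
        case-J (inj₁ p) = inj₁ p
        case-J (inj₂ (_ , j)) = j

        rest : ∀ zs → All (λ y → ¬ J y) zs → Independent π zs → Independent σ zs
        rest [] _ _ = []
        rest (z ∷ zs) (¬Jz ∷ ¬Js) (z≁zs ∷ ind) =
          All.map (λ z≁y z~y → new z≁y (σ⇒E z~y)) z≁zs ∷ rest zs ¬Js ind
          where
          new : ∀ {y} → ¬ SameCycle π z y → ¬ E z y
          new z≁y (inj₁ z~y) = z≁y z~y
          new z≁y (inj₂ (jz , _)) = ¬Jz jz

      covers′ : ∀ i → Any (SameCycle σ i) (a ∷ ys)
      covers′ i with covers i
      ... | here i~a = here (π⇒σ i~a)
      ... | there (here i~b) = here (sameCycle-trans σ (π⇒σ i~b) b~a)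
      ... | there (there i~y) = there (Any.map π⇒σ i~y)

  module _ (a≢b : a ≢ b) where

    private
      -- Iterating π from y reaches b without meeting a before.
      data Reaches : Fin n → Set where
        here : Reaches b
        step : ∀ {y} → y ≢ a → Reaches (π ⟨$⟩ʳ y) → Reaches y

      ¬reaches-a : ¬ Reaches a
      ¬reaches-a here = a≢b refl
      ¬reaches-a (step a≢a _) = a≢a refl

      -- If the path from `y` to `b` meets `a`, its part after the last visit starts at `π a` and
      -- avoids `a`.
      reaches : ∀ k y → iterate (π ⟨$⟩ʳ_) y k ≡ b → Reaches y ⊎ Reaches (π ⟨$⟩ʳ a)
      reaches zero    y refl = inj₁ here
      reaches (suc k) y p with y ≟ a | reaches k (π ⟨$⟩ʳ y) p
      ... | yes refl | inj₁ q = inj₂ q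
      ... | no y≢a   | inj₁ q = inj₁ (step y≢a q)
      ... | _        | inj₂ q = inj₂ q

    -- `Reaches` describes the arc from `π a` to `b`. `σ` follows `π` along it and closes it up by
    -- sending `b` to `π a`, so the arc is closed under `σ`; it contains `b` but not `a`.
    separate : SameCycle π a b → ¬ SameCycle σ a b
    separate (k , p) a~b = ¬reaches-a
      (sameCycle-least σ {λ x y → Reaches x → Reaches y} (λ q → q) (λ f g q → g (f q)) σ-step
        (sameCycle-sym σ a~b) here)
      where
      πa : Reaches (π ⟨$⟩ʳ a)
      πa with reaches k a p
      ... | inj₁ q = contradiction q ¬reaches-a
      ... | inj₂ q = q

      σ-step : ∀ x → Reaches x → Reaches (σ ⟨$⟩ʳ x)
      σ-step x here = subst Reaches (sym at-b) πa
      σ-step x (step x≢a q) with x ≟ b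
      ... | yes refl = subst Reaches (sym at-b) πa
      ... | no x≢b = subst Reaches (sym (elsewhere x≢a x≢b)) q

-- The same swap leads back from `σ` to `π`, and there it merges the cycles that `separate` has
-- shown to differ.
c-split : ∀ {n} {π σ : Permutation′ n} {a b} → Swapped π σ a b → a ≢ b →
          SameCycle π a b → c σ ≡ suc (c π)
c-split sw a≢b a~b = sym (c-merge (swapped-sym sw) (separate sw a≢b a~b))

swapped-swap : ∀ {n} {π σ : Permutation′ n} {a b} → Swapped π σ a b → Swapped π σ b a
swapped-swap (swapped p q e) = swapped q p λ x≢b x≢a → e x≢a x≢b

swapped-edge : ∀ {n} (π : Permutation′ n) {σ} a b →
               (∀ x → σ ⟨$⟩ʳ x ≡ (π · transpose a b) ⟨$⟩ʳ x) → Swapped π σ a b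
swapped-edge π a b eq = swapped
  (trans (eq a) (cong (π ⟨$⟩ʳ_) (transpose-i a b)))
  (trans (eq b) (cong (π ⟨$⟩ʳ_) transpose-j))
  λ {x} x≢a x≢b → trans (eq x) (cong (π ⟨$⟩ʳ_) (transpose-k x≢a x≢b))
  where
  transpose-j : transpose a b ⟨$⟩ʳ b ≡ a
  transpose-j with b ≟ a
  ... | yes b≡a = b≡a
  ... | no _ rewrite dec-true (b ≟ b) refl = refl

  transpose-k : ∀ {x} → x ≢ a → x ≢ b → transpose a b ⟨$⟩ʳ x ≡ x
  transpose-k {x} x≢a x≢b rewrite dec-false (x ≟ a) x≢a | dec-false (x ≟ b) x≢b = refl

swapped-cong : ∀ {n} {π π′ σ σ′ : Permutation′ n} {a b} → (∀ x → π ⟨$⟩ʳ x ≡ π′ ⟨$⟩ʳ x) →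
               Swapped π σ a b → Swapped π′ σ′ a b → ∀ x → σ ⟨$⟩ʳ x ≡ σ′ ⟨$⟩ʳ x
swapped-cong {a = a} {b} π≈π′ (swapped p q e) (swapped p′ q′ e′) x with x ≟ a | x ≟ b
... | yes refl | _        = trans p (trans (π≈π′ _) (sym p′))
... | no _     | yes refl = trans q (trans (π≈π′ _) (sym q′))
... | no x≢a   | no x≢b   = trans (e x≢a x≢b) (trans (π≈π′ x) (sym (e′ x≢a x≢b)))

-- Counting by sums of zeros and ones.

bit : Bool → ℕ
bit b = if b then 1 else 0

∣tabulate∣ : ∀ {n} (b : Fin n → Bool) → ∣ Vec.tabulate b ∣ ≡ sum (bit ∘ b)
∣tabulate∣ {zero}  b = refl
∣tabulate∣ {suc n} b with b zero
... | true  = cong suc (∣tabulate∣ (b ∘ suc))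
... | false = ∣tabulate∣ (b ∘ suc)

length-filter-tabulate : ∀ {A : Set} {P : A → Set} (P? : Decidable P) {n} (f : Fin n → A) →
                         length (filter P? (List.tabulate f)) ≡ sum (λ i → bit (does (P? (f i))))
length-filter-tabulate P? {zero}  f = refl
length-filter-tabulate P? {suc n} f with does (P? (f zero))
... | true  = cong suc (length-filter-tabulate P? (f ∘ suc))
... | false = length-filter-tabulate P? (f ∘ suc)

sum-const : ∀ n k → ∑[ i < n ] k ≡ n ℕ.* k
sum-const zero    k = refl
sum-const (suc n) k = cong (k ℕ.+_) (sum-const n k)

sum-change : ∀ {n} (s t : Fin n → ℕ) k → (∀ i → i ≢ k → s i ≡ t i) →
             sum s ℕ.+ t k ≡ sum t ℕ.+ s k
sum-change {suc n} s t k eq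
  rewrite sum-remove {i = k} s | sum-remove {i = k} t
        | sum-cong-≗ {x = λ i → s (punchIn k i)} (λ i → eq (punchIn k i) (punchInᵢ≢i k i))
  = lemma (s k) (t k) _
  where
  lemma : ∀ x y z → x ℕ.+ z ℕ.+ y ≡ y ℕ.+ z ℕ.+ x
  lemma = solve-∀

c≤n : ∀ {n} (π : Permutation′ n) → c π ≤ n
c≤n {n} π = ≤-trans (length-deduplicate _ (map (cycleOf π) (allFin n)))
  (≤-reflexive (trans (length-map (cycleOf π) (allFin n)) (length-tabulate {n = n} _)))

-- Fixed leaves, and the change of φ under a star transposition.

module _ {m : ℕ} where
  open import Data.Nat.Base using (_+_; _*_)

  fixedLeaf? : (π : Permutation′ (suc m)) → Decidable (λ i → π ⟨$⟩ʳ suc i ≡ suc i)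
  fixedLeaf? π i = π ⟨$⟩ʳ suc i ≟ suc i

  fixedLeaves : Permutation′ (suc m) → ℕ
  fixedLeaves π = ∑[ i < m ] bit (does (fixedLeaf? π i))

  fixedLeaves-cong : ∀ {π σ : Permutation′ (suc m)} → (∀ x → π ⟨$⟩ʳ x ≡ σ ⟨$⟩ʳ x) →
                     fixedLeaves π ≡ fixedLeaves σ
  fixedLeaves-cong π≈σ = sum-cong-≗ λ i → cong (λ y → bit (does (y ≟ suc i))) (π≈σ (suc i))

  -- A fixed centre contributes 2 through `Fix π`, a moved one contributes 2 through `r π`.
  Fix-r : ∀ π → 2 * ∣ Fix π ∣ + r π ≡ 2 + 2 * fixedLeaves π
  Fix-r π rewrite ∣tabulate∣ (λ i → does (π ⟨$⟩ʳ i ≟ i)) with does (π ⟨$⟩ʳ zero ≟ zero)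
  ... | true  = lemma (fixedLeaves π)
    where
    lemma : ∀ l → 2 * suc l + 0 ≡ 2 + 2 * l
    lemma = solve-∀
  ... | false = +-comm (2 * fixedLeaves π) 2

  fixedLeaves-length : ∀ π → length (filter (fixedLeaf? π) (allFin m)) ≡ fixedLeaves π
  fixedLeaves-length π = length-filter-tabulate (fixedLeaf? π) (λ i → i)

  fixedLeaves≤m : ∀ π → fixedLeaves π ≤ m
  fixedLeaves≤m π = subst₂ _≤_ (fixedLeaves-length π) (length-tabulate {n = m} _)
    (length-filter (fixedLeaf? π) (allFin m))

  -- The centre and the fixed leaves lie in pairwise different cycles.
  fixedLeaves<c : ∀ π → suc (fixedLeaves π) ≤ c π
  fixedLeaves<c π = subst (_≤ c π)
    (cong suc (trans (length-map suc (filter (fixedLeaf? π) (allFin m))) (fixedLeaves-length π)))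
    (length≤c π
      ( All.map⁺ (All.map (λ {i} fix 0~i → sameCycle-moved π {zero} {suc i} (λ ()) 0~i fix)
                  fixed)
      ∷ AllPairs.map⁺ (independent _ fixed (AllPairs.filter⁺ (fixedLeaf? π) (AllPairs.tabulate⁺ (λ i≢j → i≢j))))))
    where
    fixed : All (λ i → π ⟨$⟩ʳ suc i ≡ suc i) (filter (fixedLeaf? π) (allFin m))
    fixed = All.all-filter (fixedLeaf? π) (allFin m)

    independent : ∀ is → All (λ i → π ⟨$⟩ʳ suc i ≡ suc i) is → AllPairs _≢_ is →
                  AllPairs (λ i j → ¬ SameCycle π (suc i) (suc j)) is
    independent []       []           []             = []
    independent (i ∷ is) (fix ∷ fixes) (i≢is ∷ is!) =
      All.map (λ i≢j i~j → i≢j (suc-injective (sameCycle-fixed π fix i~j))) i≢is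
      ∷ independent is fixes is!

  fixedLeaves-id : ∀ {π} → (∀ x → π ⟨$⟩ʳ x ≡ x) → fixedLeaves π ≡ m
  fixedLeaves-id {π} π≈id = trans
    (sum-cong-≗ λ i → cong bit (dec-true (fixedLeaf? π i) (π≈id (suc i))))
    (trans (sum-const m 1) (*-identityʳ m))

  module _ {π σ : Permutation′ (suc m)} {k : Fin m} (sw : Swapped π σ zero (suc k)) where
    open Swapped sw

    -- Only the status of the leaf `suc k` can change, and `σ` fixes it exactly when `π` sends the
    -- centre to it.
    fixedLeaves-swap : fixedLeaves π + bit (does (π ⟨$⟩ʳ zero ≟ suc k))
                     ≡ fixedLeaves σ + bit (does (π ⟨$⟩ʳ suc k ≟ suc k))
    fixedLeaves-swap = trans
      (cong (λ y → fixedLeaves π + bit (does (y ≟ suc k))) (sym at-b))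
      (sum-change (λ i → bit (does (fixedLeaf? π i))) (λ i → bit (does (fixedLeaf? σ i))) k
        λ i i≢k → cong (λ y → bit (does (y ≟ suc i)))
          (sym (elsewhere (λ ()) (i≢k ∘ suc-injective))))

    -- This is φ σ ≤ φ π + 1 without subtraction. A split adds one cycle and loses no fixed leaf, as
    -- `suc k` was moved; a merge removes one cycle and loses at most one fixed leaf.
    swap-≤ : c σ + 2 * fixedLeaves π ≤ 1 + c π + 2 * fixedLeaves σ
    swap-≤ with sameCycle? π zero (suc k)
    ... | yes 0~b = bound (c π) (c σ) (fixedLeaves π) (fixedLeaves σ) (c-split sw (λ ()) 0~b)
      (≤-trans (m≤m+n (fixedLeaves π) _) (≤-reflexive (trans fixedLeaves-swap
        (trans (cong (λ b → fixedLeaves σ + bit b) (dec-false (fixedLeaf? π k) (sameCycle-moved π (λ ()) 0~b)))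
          (+-comm (fixedLeaves σ) 0)))))
      where
      bound : ∀ x x′ l l′ → x′ ≡ suc x → l ≤ l′ → x′ + 2 * l ≤ 1 + x + 2 * l′
      bound x _ _ _ refl l≤l′ = s≤s (+-monoʳ-≤ x (*-monoʳ-≤ 2 l≤l′))
    ... | no 0≁b = bound (c π) (c σ) (fixedLeaves π) (fixedLeaves σ) (c-merge sw 0≁b)
      (≤-trans (m≤m+n (fixedLeaves π) _) (≤-trans (≤-reflexive fixedLeaves-swap)
        (+-monoʳ-≤ (fixedLeaves σ) (bit≤1 (does (fixedLeaf? π k))))))
      where
      bit≤1 : ∀ b → bit b ≤ 1
      bit≤1 true  = ≤-refl
      bit≤1 false = z≤n

      rearrange : ∀ x l → x + 2 * (l + 1) ≡ 1 + suc x + 2 * l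
      rearrange = solve-∀

      bound : ∀ x x′ l l′ → suc x′ ≡ x → l ≤ l′ + 1 → x′ + 2 * l ≤ 1 + x + 2 * l′
      bound _ x′ l l′ refl l≤ = ≤-trans (+-monoʳ-≤ x′ (*-monoʳ-≤ 2 l≤)) (≤-reflexive (rearrange x′ l′))

    -- The swap splits off `suc k` as a new fixed leaf: one more cycle and one more fixed leaf, so φ
    -- drops by one.
    swap-image : π ⟨$⟩ʳ zero ≡ suc k → c π + 2 * fixedLeaves σ ≡ 1 + c σ + 2 * fixedLeaves π
    swap-image π0≡b =
      combine (c π) (c σ) (fixedLeaves π) (fixedLeaves σ) (c-split sw (λ ()) 0~b) eq
      where
      0~b : SameCycle π zero (suc k)
      0~b = 1 , π0≡b

      eq : fixedLeaves π + 1 ≡ fixedLeaves σ + 0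
      eq = subst₂ (λ b b′ → fixedLeaves π + bit b ≡ fixedLeaves σ + bit b′)
        (dec-true (π ⟨$⟩ʳ zero ≟ suc k) π0≡b)
        (dec-false (fixedLeaf? π k) (sameCycle-moved π (λ ()) 0~b))
        fixedLeaves-swap

      rearrange : ∀ x l → x + 2 * (l + 1) ≡ 1 + suc x + 2 * l
      rearrange = solve-∀

      combine : ∀ x x′ l l′ → x′ ≡ suc x → l + 1 ≡ l′ + 0 → x + 2 * l′ ≡ 1 + x′ + 2 * l
      combine x _ l l′ refl p =
        trans (cong (λ l → x + 2 * l) (trans (sym (+-comm l′ 0)) (sym p))) (rearrange x l)

    -- The fixed centre is merged into the cycle of `suc k`, which is moved both before and after.
    -- Only the cycle count changes, and φ drops by one.
    swap-moved : π ⟨$⟩ʳ zero ≡ zero → π ⟨$⟩ʳ suc k ≢ suc k →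
                 c π + 2 * fixedLeaves σ ≡ 1 + c σ + 2 * fixedLeaves π
    swap-moved π0≡0 moved = cong₂ (λ x l → x + 2 * l)
      (sym (c-merge sw λ 0~b → contradiction (sameCycle-fixed π π0≡0 0~b) λ ()))
      (+-cancelʳ-≡ 0 (fixedLeaves σ) (fixedLeaves π) (sym eq))
      where
      eq : fixedLeaves π + 0 ≡ fixedLeaves σ + 0
      eq = subst₂ (λ b b′ → fixedLeaves π + bit b ≡ fixedLeaves σ + bit b′)
        (dec-false (π ⟨$⟩ʳ zero ≟ suc k) λ π0≡b → contradiction (trans (sym π0≡0) π0≡b) λ ())
        (dec-false (fixedLeaf? π k) moved)
        fixedLeaves-swap

  starSwap : Permutation′ (suc m) → Fin m → Permutation′ (suc m)
  starSwap π k = π · transpose zero (suc k)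

  descent : ∀ π → ¬ (∀ x → π ⟨$⟩ʳ x ≡ x) → ∃[ k ]
            c π + 2 * fixedLeaves (starSwap π k) ≡ 1 + c (starSwap π k) + 2 * fixedLeaves π
  descent π π≉id = go (π ⟨$⟩ʳ zero) refl
    where
    sw : ∀ k → Swapped π (starSwap π k) zero (suc k)
    sw k = swapped-edge π zero (suc k) λ _ → refl

    go : ∀ x → π ⟨$⟩ʳ zero ≡ x → ∃[ k ]
         c π + 2 * fixedLeaves (starSwap π k) ≡ 1 + c (starSwap π k) + 2 * fixedLeaves π
    go (suc k) π0≡b = k , swap-image {π} {starSwap π k} (sw k) π0≡b
    go zero    π0≡0 =
      let k , moved = ¬∀⟶∃¬ m _ (fixedLeaf? π) λ fix → π≉id λ { zero → π0≡0 ; (suc i) → fix i }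
      in k , swap-moved {π} {starSwap π k} (sw k) π0≡0 moved

  -- Walks in Γ and distances from the identity.

  Γ : SimpleGraph (Sym (suc m))
  Γ = Cayley (star m)

  star-edge : ∀ {u v} → SimpleGraph._~_ Γ u v → ∃[ k ] Swapped u v zero (suc k)
  star-edge {u} (zero , zero , inj₁ (_ , q) , _) = contradiction refl q
  star-edge {u} (zero , suc k , _ , eq) = k , swapped-edge u zero (suc k) eq
  star-edge {u} (suc k , zero , _ , eq) = k , swapped-swap (swapped-edge u (suc k) zero eq)
  star-edge (suc _ , suc _ , inj₁ (() , _) , _)
  star-edge (suc _ , suc _ , inj₂ (_ , ()) , _)
  star-edge (zero , zero , inj₂ (p , _) , _) = contradiction refl p

  -- Telescoping `swap-≤` along the walk gives φ w ≤ k + φ u.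
  walk-bound : ∀ {k u w} → Walk Γ k u w → c w + 2 * fixedLeaves u ≤ k + c u + 2 * fixedLeaves w
  walk-bound {u = u} {w} ([] u≈w) = ≤-reflexive
    (sym (cong₂ (λ x l → x + 2 * l) (c-cong {π = u} {w} u≈w) (sym (fixedLeaves-cong {u} {w} u≈w))))
  walk-bound {suc k} {u} {w} (_∷_ {v = v} e p) =
    chain (c v) (2 * fixedLeaves u) (c u) (2 * fixedLeaves v) (c w) (2 * fixedLeaves w)
      (swap-≤ {u} {v} (proj₂ (star-edge {u} {v} e))) (walk-bound p)
    where
    rearrange₁ : ∀ x b y z → z + b + (x + y) ≡ (x + b) + (z + y)
    rearrange₁ = solve-∀
    rearrange₂ : ∀ k x a y w → (1 + a + y) + (k + x + w) ≡ 1 + k + a + w + (x + y)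
    rearrange₂ = solve-∀
    chain : ∀ x b a y z w → x + b ≤ 1 + a + y → z + y ≤ k + x + w → z + b ≤ 1 + k + a + w
    -- The cancelled `x + y` collects the terms of the intermediate vertex `v`.
    chain x b a y z w p q = +-cancelʳ-≤ (x + y) _ _
      (subst₂ _≤_ (sym (rearrange₁ x b y z)) (rearrange₂ k x a y w) (+-mono-≤ p q))

  walk-resp : ∀ {k u u′ v} → (∀ x → u ⟨$⟩ʳ x ≡ u′ ⟨$⟩ʳ x) → Walk Γ k u v → Walk Γ k u′ v
  walk-resp u≈u′ ([] u≈v) = [] λ x → trans (sym (u≈u′ x)) (u≈v x)
  walk-resp {u = u} {u′} u≈u′ (_∷_ {v = v} e p) = proj₂ (SimpleGraph.~-resp Γ) {v} {u} {u′} u≈u′ e ∷ p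

  walk-snoc : ∀ {k u v w} → Walk Γ k u v → SimpleGraph._~_ Γ v w → Walk Γ (suc k) u w
  walk-snoc {u = u} {v} {w} ([] u≈v) e =
    _∷_ {v = w} (proj₂ (SimpleGraph.~-resp Γ) {w} {v} {u} (λ x → sym (u≈v x)) e) ([] λ _ → refl)
  walk-snoc (e′ ∷ p) e = e′ ∷ walk-snoc p e

  -- d = m + c π - 1 - 2 fixedLeaves π, which by Fix-r is the asserted distance.
  Balanced : ℕ → Permutation′ (suc m) → Set
  Balanced d π = d + (1 + 2 * fixedLeaves π) ≡ m + c π

  -- This says that φ is nonnegative, by adding the bounds of the number of fixed leaves by `m` and
  -- by `c π` less one.
  potential≤ : ∀ π → 1 + 2 * fixedLeaves π ≤ m + c π
  potential≤ π = ≤-trans (≤-reflexive (lemma (fixedLeaves π)))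
    (+-mono-≤ (fixedLeaves≤m π) (fixedLeaves<c π))
    where
    lemma : ∀ l → 1 + 2 * l ≡ l + suc l
    lemma = solve-∀

  balanced-id : ∀ {d π} → (∀ x → π ⟨$⟩ʳ x ≡ x) → Balanced d π → d ≡ 0
  balanced-id {d} {π} π≈id bal = n≤0⇒n≡0 (+-cancelʳ-≤ (1 + 2 * m) d 0 (begin
    d + (1 + 2 * m)             ≡⟨ cong (λ l → d + (1 + 2 * l)) (fixedLeaves-id {π} π≈id) ⟨
    d + (1 + 2 * fixedLeaves π) ≡⟨ bal ⟩
    m + c π                     ≤⟨ +-monoʳ-≤ m (c≤n π) ⟩
    m + suc m                   ≡⟨ rearrange m ⟩
    1 + 2 * m                   ∎))
    where
    open ≤-Reasoning
    rearrange : ∀ k → k + suc k ≡ 1 + 2 * k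
    rearrange = solve-∀

  -- The conclusion reads φ σ = d - 1, with the 1 moved across so that it also makes sense for `d`
  -- equal to 0.
  balanced-descent : ∀ {d π σ} → c π + 2 * fixedLeaves σ ≡ 1 + c σ + 2 * fixedLeaves π →
                     Balanced d π → d + (1 + 2 * fixedLeaves σ) ≡ suc (m + c σ)
  balanced-descent {d} {π} {σ} desc bal = combine d (c π) (c σ) (fixedLeaves π) (fixedLeaves σ) desc bal
    where
    rearrange₁ : ∀ d l l′ → d + (1 + 2 * l′) + (1 + 2 * l) ≡ d + (1 + 2 * l) + (1 + 2 * l′)
    rearrange₁ = solve-∀
    rearrange₂ : ∀ k x l′ → k + x + (1 + 2 * l′) ≡ k + 1 + (x + 2 * l′)
    rearrange₂ = solve-∀
    rearrange₃ : ∀ k x′ l → k + 1 + (1 + x′ + 2 * l) ≡ suc (k + x′) + (1 + 2 * l)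
    rearrange₃ = solve-∀

    combine : ∀ d x x′ l l′ → x + 2 * l′ ≡ 1 + x′ + 2 * l → d + (1 + 2 * l) ≡ m + x →
              d + (1 + 2 * l′) ≡ suc (m + x′)
    combine d x x′ l l′ p q = +-cancelʳ-≡ (1 + 2 * l) _ _
      (trans (rearrange₁ d l l′) (trans (cong (_+ (1 + 2 * l′)) q)
        (trans (rearrange₂ m x l′) (trans (cong (m + 1 +_) p) (rearrange₃ m x′ l)))))

  walk-from-id : ∀ d π → Balanced d π → Walk Γ d id π
  walk-from-id d π bal = by-cases d bal (all? λ x → π ⟨$⟩ʳ x ≟ x)
    where
    by-cases : ∀ d → Balanced d π → Dec (∀ x → π ⟨$⟩ʳ x ≡ x) → Walk Γ d id π
    by-cases d bal (yes π≈id) = subst (λ d → Walk Γ d id π) (sym (balanced-id {d} {π} π≈id bal))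
      ([] λ x → sym (π≈id x))
    by-cases d bal (no π≉id) with descent π π≉id
    ... | k , desc = down d bal
      where
      σ = starSwap π k

      down : ∀ d → Balanced d π → Walk Γ d id π
      -- Here φ of the neighbour `σ` would be -1, contrary to `potential≤`.
      down zero bal = contradiction
        (subst (_≤ m + c σ) (balanced-descent {zero} {π} {σ} desc bal) (potential≤ σ)) 1+n≰n
      down (suc d) bal = walk-snoc
        (walk-from-id d σ (ℕ-suc-injective (balanced-descent {suc d} {π} {σ} desc bal)))
        (SimpleGraph.~-sym Γ {π} {σ} (zero , suc k , inj₁ (refl , λ ()) , λ _ → refl))

  -- Minimality is `walk-bound` started at `id`, where all `m` leaves are fixed and there are at
  -- most `suc m` cycles, so that φ is at most 0.
  isDistance-id : ∀ {d π} → Balanced d π → IsDistance Γ id π d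
  isDistance-id {d} {π} bal = walk-from-id d π bal , λ k p →
    +-cancelʳ-≤ (m + (1 + 2 * fixedLeaves π)) d k (begin
      d + (m + (1 + 2 * fixedLeaves π))          ≡⟨ lemma₁ d m (1 + 2 * fixedLeaves π) ⟩
      m + (d + (1 + 2 * fixedLeaves π))          ≡⟨ cong (m +_) bal ⟩
      m + (m + c π)                              ≡⟨ lemma₂ m (c π) ⟩
      c π + 2 * m                                ≡⟨ cong (λ l → c π + 2 * l) (fixedLeaves-id {id} λ _ → refl) ⟨
      c π + 2 * fixedLeaves id                   ≤⟨ walk-bound p ⟩
      k + c {suc m} id + 2 * fixedLeaves π       ≤⟨ +-monoˡ-≤ _ (+-monoʳ-≤ k (c≤n {suc m} id)) ⟩
      k + suc m + 2 * fixedLeaves π              ≡⟨ lemma₃ k m (fixedLeaves π) ⟩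
      k + (m + (1 + 2 * fixedLeaves π))          ∎)
    where
    open ≤-Reasoning
    lemma₁ : ∀ d m l → d + (m + l) ≡ m + (d + l)
    lemma₁ = solve-∀
    lemma₂ : ∀ m x → m + (m + x) ≡ x + 2 * m
    lemma₂ = solve-∀
    lemma₃ : ∀ k m l → k + suc m + 2 * l ≡ k + (m + (1 + 2 * l))
    lemma₃ = solve-∀

  -- Left translation and distances between arbitrary permutations.

  walk-respʳ : ∀ {k u v v′} → (∀ x → v ⟨$⟩ʳ x ≡ v′ ⟨$⟩ʳ x) → Walk Γ k u v → Walk Γ k u v′
  walk-respʳ v≈v′ ([] u≈v) = [] λ x → trans (u≈v x) (v≈v′ x)
  walk-respʳ v≈v′ (e ∷ p)  = e ∷ walk-respʳ v≈v′ p

  walk-translate : ∀ {k u v} g → Walk Γ k u v → Walk Γ k (g · u) (g · v)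
  walk-translate g ([] u≈v) = [] λ x → cong (g ⟨$⟩ʳ_) (u≈v x)
  walk-translate g (_∷_ {v = v} (i , j , e , eq) p) =
    _∷_ {v = g · v} (i , j , e , λ x → cong (g ⟨$⟩ʳ_) (eq x)) (walk-translate g p)

  -- Generators act on the right, so left multiplication preserves edges. Multiplying by `u` moves a
  -- walk from `id` to one from `u`; multiplying by `flip u` moves any competitor back.
  isDistance : ∀ {d} u v → Balanced d (flip u · v) → IsDistance Γ u v d
  isDistance {d} u v bal =
    let p , shortest = isDistance-id {d = d} {π = flip u · v} bal in
    walk-respʳ (λ _ → inverseʳ u) (walk-resp (λ _ → refl) (walk-translate u p))
    , λ k q → shortest k (walk-resp (λ _ → inverseˡ u) (walk-translate (flip u) q))

  -- A finite enumeration of the symmetric group and a permutation of maximal φ.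

  -- The endpoints of all walks of length exactly `k` from `g`, up to pointwise equality and with
  -- repetitions; nearer vertices may occur.
  sphere : ℕ → Permutation′ (suc m) → List (Permutation′ (suc m))
  sphere zero    g = [ g ]
  sphere (suc k) g = concatMap (λ i → sphere k (starSwap g i)) (allFin m)

  walk⇒sphere : ∀ {k u u′ w} → (∀ x → u ⟨$⟩ʳ x ≡ u′ ⟨$⟩ʳ x) → Walk Γ k u w →
                Any (λ g → ∀ x → w ⟨$⟩ʳ x ≡ g ⟨$⟩ʳ x) (sphere k u′)
  walk⇒sphere u≈u′ ([] u≈w) = here λ x → trans (sym (u≈w x)) (u≈u′ x)
  walk⇒sphere {suc k} {u} {u′} u≈u′ (_∷_ {v = v} e p) =
    let i , sw = star-edge {u = u} {v} e in
    Any.concatMap⁺ (λ i → sphere k (starSwap u′ i)) (lose (∈-allFin i) (walk⇒sphere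
      (swapped-cong {π = u} {u′} {v} {starSwap u′ i} u≈u′ sw (swapped-edge u′ zero (suc i) λ _ → refl)) p))

  opaque
    -- φ as a natural number; the truncated subtraction is exact by `potential≤`.
    height : Permutation′ (suc m) → ℕ
    height π = m + c π ∸ (1 + 2 * fixedLeaves π)

    height-balanced : ∀ π → Balanced (height π) π
    height-balanced π = m∸n+n≡m (potential≤ π)

    height-cong : ∀ {π σ} → (∀ x → π ⟨$⟩ʳ x ≡ σ ⟨$⟩ʳ x) → height π ≡ height σ
    height-cong {π} {σ} π≈σ = cong₂ (λ x l → m + x ∸ (1 + 2 * l))
      (c-cong {π = π} {σ} π≈σ) (fixedLeaves-cong {π = π} {σ} π≈σ)

    height≤ : ∀ π → height π ≤ m + suc m
    height≤ π = ≤-trans (m∸n≤m (m + c π) (1 + 2 * fixedLeaves π)) (+-monoʳ-≤ m (c≤n π))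

  -- Every permutation ends a walk from `id` of length its height, which is at most `m + suc m`; the
  -- outer `suc` makes `upTo` include that bound.
  permutations : List (Permutation′ (suc m))
  permutations = concatMap (λ k → sphere k id) (upTo (suc (m + suc m)))

  ∈permutations : ∀ π → Any (λ g → ∀ x → π ⟨$⟩ʳ x ≡ g ⟨$⟩ʳ x) permutations
  ∈permutations π = Any.concatMap⁺ (λ k → sphere k id) (lose (∈-upTo⁺ (s≤s (height≤ π)))
    (walk⇒sphere {height π} {id} {id} {π} (λ _ → refl) (walk-from-id (height π) π (height-balanced π))))

  highest : Permutation′ (suc m)
  highest = argmax height id permutations

  height≤highest : ∀ π → height π ≤ height highest
  height≤highest π = v≤f[argmax]⁺ {f = height} {height π} id permutations
    (inj₂ (Any.map (λ {g} π≈g → ≤-reflexive (height-cong {π} {g} π≈g)) (∈permutations π)))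

  -- Distances in the star and their sum along a permutation.

  isDistance-star : ∀ i j → IsDistance (star m) i j (distStar m i j)
  isDistance-star i j = proj₂ (distance (star m) (star-~? m) (star-connected m) i j)

  distStar-unique : ∀ i j {d} → IsDistance (star m) i j d → distStar m i j ≡ d
  distStar-unique i j {d} (p , shortest) with isDistance-star i j
  ... | q , shortest′ = ≤-antisym (shortest′ d p) (shortest _ q)

  distStar-refl : ∀ i → distStar m i i ≡ 0
  distStar-refl i = distStar-unique i i ([] refl , λ _ _ → z≤n)

  distStar-centre-leaf : ∀ j → distStar m zero (suc j) ≡ 1
  distStar-centre-leaf j = distStar-unique zero (suc j) (inj₁ (refl , λ ()) ∷ [] refl ,
    λ { zero ([] ()) ; (suc _) _ → s≤s z≤n })

  distStar-leaf-centre : ∀ i → distStar m (suc i) zero ≡ 1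
  distStar-leaf-centre i = distStar-unique (suc i) zero (inj₂ ((λ ()) , refl) ∷ [] refl ,
    λ { zero ([] ()) ; (suc _) _ → s≤s z≤n })

  distStar-leaves : ∀ {i j} → i ≢ j → distStar m (suc i) (suc j) ≡ 2
  distStar-leaves {i} {j} i≢j = distStar-unique (suc i) (suc j)
    ( inj₂ ((λ ()) , refl) ∷ (inj₁ (refl , λ ()) ∷ [] refl)
    , λ { zero ([] refl) → contradiction refl i≢j
        ; (suc zero) (inj₁ (() , _) ∷ [] refl)
        ; (suc zero) (inj₂ (_ , ()) ∷ [] refl)
        ; (suc (suc _)) _ → s≤s (s≤s z≤n) })

  isCentre : Fin (suc m) → ℕ
  isCentre i = bit (does (i ≟ zero))

  -- Corrects distStar-formula for i = j = zero, where both isCentre terms are superfluous.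
  centreFixed : Fin (suc m) → Fin (suc m) → ℕ
  centreFixed zero    j = 2 * isCentre j
  centreFixed (suc _) _ = 0

  -- The default distance is 2, through the centre. Equality of the ends saves 2 and each end at the
  -- centre saves 1; only when both are the centre does this count too much.
  distStar-formula : ∀ i j → let f = bit (does (j ≟ i)) in
                     distStar m i j + ((f + f) + (isCentre i + isCentre j)) ≡ 2 + centreFixed i j
  distStar-formula zero    zero    = cong (_+ 4) (distStar-refl zero)
  distStar-formula zero    (suc j) = cong (_+ 1) (distStar-centre-leaf j)
  distStar-formula (suc i) zero    = cong (_+ 1) (distStar-leaf-centre i)
  distStar-formula (suc i) (suc j) = leaves i j (j ≟ i)
    where
    leaves : ∀ i j (j≟i : Dec (j ≡ i)) → let f = bit (does j≟i) in
             distStar m (suc i) (suc j) + ((f + f) + 0) ≡ 2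
    leaves i .i (yes refl) = cong (_+ 2) (distStar-refl (suc i))
    leaves i j  (no j≢i)   = cong (_+ 0) (distStar-leaves λ i≡j → j≢i (sym i≡j))

  sum-isCentre : ∑[ i < suc m ] isCentre i ≡ 1
  sum-isCentre = cong suc (trans (sum-const m 0) (*-zeroʳ m))

  -- Summing `distStar-formula` over `i` leaves `centreFixed` only at the centre, and `r-formula`
  -- turns that term into `r π`.
  distStar-sum : ∀ π → (∑[ i < suc m ] distStar m i (π ⟨$⟩ʳ i)) + (2 * ∣ Fix π ∣ + r π) ≡ suc m * 2
  distStar-sum π = rearrange S ∣ Fix π ∣ (isCentre (π ⟨$⟩ʳ zero)) (r π) (suc m * 2) total r-formula
    where
    S = ∑[ i < suc m ] distStar m i (π ⟨$⟩ʳ i)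
    f : Fin (suc m) → ℕ
    f i = bit (does (π ⟨$⟩ʳ i ≟ i))

    r-formula : r π + 2 * isCentre (π ⟨$⟩ʳ zero) ≡ 2
    r-formula with does (π ⟨$⟩ʳ zero ≟ zero)
    ... | true  = refl
    ... | false = refl

    open ≡-Reasoning
    total : S + ((∣ Fix π ∣ + ∣ Fix π ∣) + (1 + 1)) ≡ suc m * 2 + 2 * isCentre (π ⟨$⟩ʳ zero)
    total = begin
      S + ((∣ Fix π ∣ + ∣ Fix π ∣) + (1 + 1))
        -- Exactly one `i` is the centre and, `π` being a bijection, exactly one `i` is mapped to
        -- it.
        ≡⟨ cong₂ (λ a b → S + ((a + a) + b)) (∣tabulate∣ (λ i → does (π ⟨$⟩ʳ i ≟ i)))
             (cong₂ _+_ (sym sum-isCentre) (trans (sym sum-isCentre) (sum-permute isCentre π))) ⟩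
      S + ((sum f + sum f) + (sum isCentre + sum (λ i → isCentre (π ⟨$⟩ʳ i))))
        ≡⟨ cong (S +_) (cong₂ _+_ (∑-distrib-+ f f) (∑-distrib-+ isCentre λ i → isCentre (π ⟨$⟩ʳ i))) ⟨
      S + (sum (λ i → f i + f i) + sum (λ i → isCentre i + isCentre (π ⟨$⟩ʳ i)))
        ≡⟨ cong (S +_) (∑-distrib-+ (λ i → f i + f i) (λ i → isCentre i + isCentre (π ⟨$⟩ʳ i))) ⟨
      S + sum (λ i → (f i + f i) + (isCentre i + isCentre (π ⟨$⟩ʳ i)))
        ≡⟨ ∑-distrib-+ (λ i → distStar m i (π ⟨$⟩ʳ i)) (λ i → (f i + f i) + (isCentre i + isCentre (π ⟨$⟩ʳ i))) ⟨
      sum (λ i → distStar m i (π ⟨$⟩ʳ i) + ((f i + f i) + (isCentre i + isCentre (π ⟨$⟩ʳ i))))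
        ≡⟨ sum-cong-≗ (λ i → distStar-formula i (π ⟨$⟩ʳ i)) ⟩
      sum (λ i → 2 + centreFixed i (π ⟨$⟩ʳ i))
        ≡⟨ ∑-distrib-+ {suc m} (λ _ → 2) (λ i → centreFixed i (π ⟨$⟩ʳ i)) ⟩
      sum {suc m} (λ _ → 2) + (2 * isCentre (π ⟨$⟩ʳ zero) + sum {m} (λ _ → 0))
        ≡⟨ cong₂ (λ a b → a + (2 * isCentre (π ⟨$⟩ʳ zero) + b)) (sum-const (suc m) 2) (trans (sum-const m 0) (*-zeroʳ m)) ⟩
      suc m * 2 + (2 * isCentre (π ⟨$⟩ʳ zero) + 0)
        ≡⟨ cong (suc m * 2 +_) (+-identityʳ (2 * isCentre (π ⟨$⟩ʳ zero))) ⟩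
      suc m * 2 + 2 * isCentre (π ⟨$⟩ʳ zero) ∎

    rearrange : ∀ s x y r n → s + ((x + x) + 2) ≡ n + 2 * y → r + 2 * y ≡ 2 → s + (2 * x + r) ≡ n
    rearrange s x y r n p q = +-cancelʳ-≡ (2 * y) _ _ (begin
      s + (2 * x + r) + 2 * y   ≡⟨ lemma s x y r ⟩
      s + ((x + x) + (r + 2 * y)) ≡⟨ cong (λ z → s + ((x + x) + z)) q ⟩
      s + ((x + x) + 2)         ≡⟨ p ⟩
      n + 2 * y                 ∎)
      where
      lemma : ∀ s x y r → s + (2 * x + r) + 2 * y ≡ s + ((x + x) + (r + 2 * y))
      lemma = solve-∀

  balanced-Fix-r : ∀ {d} π → Balanced d π → d + (2 * ∣ Fix π ∣ + r π) ≡ suc m + c π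
  balanced-Fix-r {d} π bal = trans (cong (d +_) (Fix-r π)) (trans (lemma d (fixedLeaves π)) (cong suc bal))
    where
    lemma : ∀ d l → d + (2 + 2 * l) ≡ suc (d + (1 + 2 * l))
    lemma = solve-∀

  -- Eliminating `2 * ∣ Fix π ∣ + r π` between `balanced-Fix-r` and `distStar-sum` identifies the
  -- maximised expression with φ.
  balanced-sum : ∀ {d} π → Balanced d π → c π + (∑[ i < suc m ] distStar m i (π ⟨$⟩ʳ i)) ≡ d + suc m
  balanced-sum {d} π bal = combine d (c π) (∑[ i < suc m ] distStar m i (π ⟨$⟩ʳ i)) (2 * ∣ Fix π ∣ + r π) (suc m)
    (balanced-Fix-r {d} π bal) (distStar-sum π)
    where
    open ≡-Reasoning
    combine : ∀ d x s f n → d + f ≡ n + x → s + f ≡ n * 2 → x + s ≡ d + n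
    combine d x s f n p q = +-cancelʳ-≡ f _ _ (begin
      x + s + f   ≡⟨ lemma₁ x s f ⟩
      x + (s + f) ≡⟨ cong (x +_) q ⟩
      x + n * 2   ≡⟨ lemma₂ x n ⟩
      n + x + n   ≡⟨ cong (_+ n) p ⟨
      d + f + n   ≡⟨ lemma₃ d f n ⟩
      d + n + f   ∎)
      where
      lemma₁ : ∀ x s f → x + s + f ≡ x + (s + f)
      lemma₁ = solve-∀
      lemma₂ : ∀ x n → x + n * 2 ≡ n + x + n
      lemma₂ = solve-∀
      lemma₃ : ∀ d f n → d + f + n ≡ d + n + f
      lemma₃ = solve-∀

-- Passage to integer subtraction, and the two formulas.

open import Data.Integer.Base as ℤ using (+_; _+_; _-_; _*_; +≤+)
open import Data.Integer.Properties using (pos-*)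
import Data.Integer.Tactic.RingSolver as ℤ

difference : ∀ d f x n k → d ℕ.+ (2 ℕ.* f ℕ.+ x) ≡ n ℕ.+ k → + d ≡ + n + + k - + 2 * + f - + x
difference d f x n k eq = trans (cancel (+ d) (+ 2 * + f) (+ x))
  (cong (λ z → z - + 2 * + f - + x)
    (trans (cong (λ z → + d + (z + + x)) (sym (pos-* 2 f))) (cong +_ eq)))
  where
  cancel : ∀ d f x → d ≡ d + (f + x) - f - x
  cancel = ℤ.solve-∀

excess : ∀ d k s n → k ℕ.+ s ≡ d ℕ.+ n → + k - + n + + s ≡ + d
excess d k s n eq = trans (rearrange (+ k) (+ n) (+ s))
  (trans (cong (λ z → z - + n) (cong +_ eq)) (cancel (+ d) (+ n)))
  where
  rearrange : ∀ k n s → k - n + s ≡ k + s - n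
  rearrange = ℤ.solve-∀
  cancel : ∀ d n → d + n - n ≡ d
  cancel = ℤ.solve-∀

corollary6 : ∀ (m : ℕ) → 5 ≤ suc m →
    (∀ (π : Permutation′ (suc m)) → ∃[ d ] IsDistance (Cayley (star m)) id π d × + d ≡ + suc m + + c π - + 2 * + ∣ Fix π ∣ - + r π)
    × (∃[ D ] IsDiameter (Cayley (star m)) D × IsMaximum (λ (π : Permutation′ (suc m)) → + c π - + suc m + + (∑[ i < suc m ] distStar m i (π ⟨$⟩ʳ i))) (+ D))
corollary6 m _ =
  (λ π → height π , isDistance-id {d = height π} {π = π} (height-balanced π) ,
    difference (height π) ∣ Fix π ∣ (r π) (suc m) (c π) (balanced-Fix-r {d = height π} π (height-balanced π)))
  , height highest
  , ( (λ u v → height (flip u · v)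
             , isDistance {d = height (flip u · v)} u v (height-balanced (flip u · v))
             , height≤highest (flip u · v))
    -- Every distance is the height of some `flip u · v`, so the greatest height is attained as a
    -- distance from `id`.
    , id , highest , isDistance-id {d = height highest} {π = highest} (height-balanced highest))
  , (λ π → subst (ℤ._≤ + height highest) (sym (excess≡height π)) (+≤+ (height≤highest π)))
  , highest , excess≡height highest
  where
  excess≡height : ∀ π → + c π - + suc m + + (∑[ i < suc m ] distStar m i (π ⟨$⟩ʳ i)) ≡ + height π
  excess≡height π = excess (height π) (c π) (∑[ i < suc m ] distStar m i (π ⟨$⟩ʳ i)) (suc m)
    (balanced-sum {d = height π} π (height-balanced π))
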